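{- Let $\Sigma=\langle\mathcal A,\leq_{\mathcal A},\mathcal A\rangle$ be the subexponential signature given by a c-semiring $\langle \mathcal A,+_{\mathcal A},\times_{\mathcal A},\bot_{\mathcal A},\top_{\mathcal A}\rangle$. Then the system $\mathrm{SELLS}_\Sigma$ admits cut-elimination; that is, every sequent provable in $\mathrm{SELLS}_\Sigma$ extended with the rule $$\text{(Cut)}\qquad \text{from } \Gamma\longrightarrow G\ \text{ and }\ \Delta,G\longrightarrow F\ \text{ infer }\ \Gamma,\Delta\longrightarrow F$$ is provable in $\mathrm{SELLS}_\Sigma$ without Cut.
   Context: **C-semiring.** A tuple $\langle \mathcal A,+_{\mathcal A},\times_{\mathcal A},\bot_{\mathcal A},\top_{\mathcal A}\rangle$ where $+_{\mathcal A}$ is a commutative, associative, idempotent binary operation on the set $\mathcal A$ with unit $\bot_{\mathcal A}$ and absorbing element $\top_{\mathcal A}$; $\times_{\mathcal A}$ is an associative, commutative binary operation on $\mathcal A$ (not necessarily idempotent) with unit $\top_{\mathcal A}$ and absorbing element $\bot_{\mathcal A}$, and it distributes over $+_{\mathcal A}$. The order is $a\leq_{\mathcal A} b$ iff $a+_{\mathcal A}b=b$, and $\langle\mathcal A,\leq_{\mathcal A}\rangle$ is a complete lattice with bottom $\bot_{\mathcal A}$, top $\top_{\mathcal A}$ and least upper bound operation $+_{\mathcal A}$; $+_{\mathcal A}$ and $\times_{\mathcal A}$ are monotone and $a\times_{\mathcal A}b\leq_{\mathcal A}a$. **The system $\mathrm{SELLS}_\Sigma$.** Formulas are first-order formulas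 built from atoms with $\otimes,\mathbf 1,\top,\multimap,\&,\exists,\forall$ and a connective $!^a$ for each $a\in\mathcal A$. Sequents are $\Gamma\longrightarrow G$, with $\Gamma$ a multiset of formulas and $G$ a formula. In the signature $\Sigma=\langle\mathcal A,\leq_{\mathcal A},\mathcal A\rangle$, the last component says that every label in $\mathcal A$ allows weakening and contraction. The rules are ($e$ a fresh variable, $t$ a term): - initial: $A\longrightarrow A$; - $\otimes_L$: from $\Gamma,F,H\longrightarrow G$ infer $\Gamma,F\otimes H\longrightarrow G$; $\otimes_R$: from $\Gamma_1\longrightarrow F$ and $\Gamma_2\longrightarrow H$ infer $\Gamma_1,\Gamma_2\longrightarrow F\otimes H$; - $\mathbf 1_L$: from $\Gamma\longrightarrow G$ infer $\Gamma,\mathbf 1\longrightarrow G$; $\mathbf 1_R$: $\longrightarrow\mathbf 1$; $\top_R$: $\Gamma\longrightarrow\top$; - $\multimap_L$: from $\Gamma_1\longrightarrow F$ and $\Gamma_2,H\longrightarrow G$ infer $\Gamma_1,\Gamma_2,F\multimap H\longrightarrow G$; $\multimap_R$: from $\Gamma,F\longrightarrow H$ infer $\Gamma\longrightarrow F\multimap H$; - $\&_{L_i}$: from $\Gamma,F_i\longrightarrow G$ infer $\Gamma,F_1\& F_2\longrightarrow G$ ($i=1,2$); $\&_R$: from $\Gamma\longrightarrow F$ and $\Gamma\longrightarrow H$ infer $\Gamma\longrightarrow F\& H$; - $\exists_L$: from $\Gamma,F[e/x]\longrightarrow G$ infer $\Gamma,\exists x.F\longrightarrow G$; $\exists_R$: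 from $\Gamma\longrightarrow G[t/x]$ infer $\Gamma\longrightarrow\exists x.G$; - $\forall_L$: from $\Gamma,F[t/x]\longrightarrow G$ infer $\Gamma,\forall x.F\longrightarrow G$; $\forall_R$: from $\Gamma\longrightarrow G[e/x]$ infer $\Gamma\longrightarrow\forall x.G$; - for each $a\in\mathcal A$, dereliction: from $\Gamma,F\longrightarrow G$ infer $\Gamma,!^aF\longrightarrow G$; - for each $a\in\mathcal A$, promotion: from $!^{a_1}F_1,\dots,!^{a_n}F_n\longrightarrow F$ infer $!^{a_1}F_1,\dots,!^{a_n}F_n\longrightarrow{!^a}F$, provided $a\leq_{\mathcal A}a_1\times_{\mathcal A}\cdots\times_{\mathcal A}a_n$ (the empty product being the unit $\top_{\mathcal A}$); - for each $b\in\mathcal A$, weakening: from $\Gamma\longrightarrow G$ infer $\Gamma,!^bF\longrightarrow G$; and contraction: from $\Gamma,!^bF,!^bF\longrightarrow G$ infer $\Gamma,!^bF\longrightarrow G$. -}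

module Defs where

open import Algebra.Definitions using (Idempotent; Zero)
open import Algebra.Structures using (IsCommutativeSemiring)
open import Data.List.Base using (List; []; _∷_; _++_; map; foldr)
open import Data.List.Relation.Binary.Permutation.Propositional using (_↭_)
open import Data.Nat.Base using (ℕ; zero; suc)
open import Data.Product.Base using (_×_; _,_; proj₁; proj₂; ∃)
open import Data.Vec.Base using (Vec; []; _∷_)
open import Level using (Level; _⊔_) renaming (suc to lsuc)
open import Relation.Binary.PropositionalEquality
  using (_≡_; refl; sym; trans; cong; cong₂; subst; isEquivalence; module ≡-Reasoning)
open import Relation.Binary.Structures using (IsPartialOrder)
open import Relation.Nullary.Negation.Core using (¬_)
open import Relation.Unary using (Pred)

record CSemiring c : Set (lsuc c) where
  infixl 6 _+_
  infixl 7 _*_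
  infix  4 _≤_
  field
    Carrier : Set c
    _+_ _*_ : Carrier → Carrier → Carrier
    ⊥ ⊤     : Carrier

    isCommutativeSemiring : IsCommutativeSemiring _≡_ _+_ _*_ ⊥ ⊤
    +-idem                : Idempotent _≡_ _+_
    +-zero                : Zero _≡_ ⊤ _+_

  open IsCommutativeSemiring isCommutativeSemiring public
    using ( +-assoc; +-comm; +-identity; +-identityˡ; +-identityʳ
          ; *-assoc; *-comm; *-identity; *-identityˡ; *-identityʳ
          ; distrib; distribˡ; distribʳ )

  _≤_ : Carrier → Carrier → Set c
  a ≤ b = a + b ≡ b

  IsLeastUpperBound : Pred Carrier c → Carrier → Set c
  IsLeastUpperBound P s = (∀ a → P a → a ≤ s) × (∀ b → (∀ a → P a → a ≤ b) → s ≤ b)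

  -- Existence of suprema is the classical one.  A plain ∃ would already make
  -- weak excluded middle a precondition for the two-element c-semiring to be an
  -- instance; under excluded middle the two versions agree.
  -- Infima are the suprema of the sets of lower bounds.
  field
    complete : ∀ P → ¬ ¬ ∃ (IsLeastUpperBound P)

  -- The remaining order-theoretic properties of c-semirings are consequences.

  ≤-isPartialOrder : IsPartialOrder _≡_ _≤_
  ≤-isPartialOrder = record
    { isPreorder = record
      { isEquivalence = isEquivalence
      ; reflexive     = λ { refl → +-idem _ }
      ; trans         = λ {a} {b} {d} a≤b b≤d → begin
          a + d        ≡⟨ cong (a +_) b≤d ⟨
          a + (b + d)  ≡⟨ +-assoc a b d ⟨
          a + b + d    ≡⟨ cong (_+ d) a≤b ⟩
          b + d        ≡⟨ b≤d ⟩
          d            ∎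
      }
    ; antisym = λ {a} {b} a≤b b≤a → trans (sym b≤a) (trans (+-comm b a) a≤b)
    }
    where open ≡-Reasoning

  open IsPartialOrder ≤-isPartialOrder public
    using () renaming (refl to ≤-refl; trans to ≤-trans; antisym to ≤-antisym)

  ⊥-minimum : ∀ a → ⊥ ≤ a
  ⊥-minimum = +-identityˡ

  ⊤-maximum : ∀ a → a ≤ ⊤
  ⊤-maximum = proj₂ +-zero

  a≤a+b : ∀ a b → a ≤ a + b
  a≤a+b a b = trans (sym (+-assoc a a b)) (cong (_+ b) (+-idem a))

  b≤a+b : ∀ a b → b ≤ a + b
  b≤a+b a b = subst (b ≤_) (+-comm b a) (a≤a+b b a)

  +-least : ∀ {a b d} → a ≤ d → b ≤ d → a + b ≤ d
  +-least {a} {b} {d} a≤d b≤d = trans (+-assoc a b d) (trans (cong (a +_) b≤d) a≤d)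

  +-mono-≤ : ∀ {a a′ b b′} → a ≤ a′ → b ≤ b′ → a + b ≤ a′ + b′
  +-mono-≤ a≤a′ b≤b′ =
    +-least (≤-trans a≤a′ (a≤a+b _ _)) (≤-trans b≤b′ (b≤a+b _ _))

  *-mono-≤ : ∀ {a a′ b b′} → a ≤ a′ → b ≤ b′ → a * b ≤ a′ * b′
  *-mono-≤ {a} {a′} {b} {b′} a≤a′ b≤b′ =
    ≤-trans (trans (sym (distribʳ b a a′)) (cong (_* b) a≤a′))
            (trans (sym (distribˡ a′ b b′)) (cong (a′ *_) b≤b′))

  a*b≤a : ∀ a b → a * b ≤ a
  a*b≤a a b = subst (a * b ≤_) (*-identityʳ a) (*-mono-≤ (≤-refl {a}) (⊤-maximum b))

record Language f r : Set (lsuc (f ⊔ r)) where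
  field
    Fun      : Set f
    Rel      : Set r
    funArity : Fun → ℕ
    relArity : Rel → ℕ

module SELLS {c f r : Level} (𝒜 : CSemiring c) (L : Language f r) where

  open CSemiring 𝒜 using (_≤_) renaming (Carrier to Label; _*_ to _*ᴬ_; ⊤ to ⊤ᴬ)
  open Language L

  -- Variables are de Bruijn indices.  Indices beyond the enclosing quantifiers
  -- are the free variables, of which there are infinitely many.
  data Term : Set f where
    var : ℕ → Term
    fun : (g : Fun) → Vec Term (funArity g) → Term

  infixr 8 _⊗_
  infixr 7 _&_
  infixr 6 _⊸_

  data Formula : Set (c ⊔ f ⊔ r) where
    atom        : (p : Rel) → Vec Term (relArity p) → Formula
    _⊗_ _⊸_ _&_ : Formula → Formula → Formula
    𝟏 ⊤         : Formula
    ∃′ ∀′       : Formula → Formula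
    !           : Label → Formula → Formula

  Subst : Set f
  Subst = ℕ → Term

  mutual
    substTerm : Subst → Term → Term
    substTerm σ (var x)    = σ x
    substTerm σ (fun g ts) = fun g (substTerms σ ts)

    substTerms : ∀ {n} → Subst → Vec Term n → Vec Term n
    substTerms σ []       = []
    substTerms σ (t ∷ ts) = substTerm σ t ∷ substTerms σ ts

  shiftVar : Subst
  shiftVar x = var (suc x)

  lift : Subst → Subst
  lift σ zero    = var zero
  lift σ (suc x) = substTerm shiftVar (σ x)

  substFormula : Subst → Formula → Formula
  substFormula σ (atom p ts) = atom p (substTerms σ ts)
  substFormula σ (F ⊗ H)     = substFormula σ F ⊗ substFormula σ H
  substFormula σ (F ⊸ H)     = substFormula σ F ⊸ substFormula σ H
  substFormula σ (F & H)     = substFormula σ F & substFormula σ H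
  substFormula σ 𝟏           = 𝟏
  substFormula σ ⊤           = ⊤
  substFormula σ (∃′ F)      = ∃′ (substFormula (lift σ) F)
  substFormula σ (∀′ F)      = ∀′ (substFormula (lift σ) F)
  substFormula σ (! a F)     = ! a (substFormula σ F)

  instVar : Term → Subst
  instVar t zero    = t
  instVar t (suc x) = var x

  -- F [ t ] is F[t/x], for F the body of a quantifier binding x.
  infix 9 _[_]
  _[_] : Formula → Term → Formula
  F [ t ] = substFormula (instVar t) F

  shift : Formula → Formula
  shift = substFormula shiftVar

  data CutMode : Set where
    cut-free with-cut : CutMode

  bang : Label × Formula → Formula
  bang (a , F) = ! a F

  ∏ : List Label → Label
  ∏ = foldr _*ᴬ_ ⊤ᴬ

  infix 3 _∣_⟶_

  -- Multisets are lists subject to the rule `exchange`.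
  --
  -- In ∃L and ∀R the eigenvariable e is index 0 of the premise: shifting the
  -- rest of the sequent makes that index fresh, and the body of the quantifier
  -- is then F[e/x] as it stands.
  data _∣_⟶_ (κ : CutMode) : List Formula → Formula → Set (c ⊔ f ⊔ r) where

    exchange : ∀ {Γ Δ G} → Γ ↭ Δ → κ ∣ Γ ⟶ G → κ ∣ Δ ⟶ G

    initial : ∀ {A} → κ ∣ A ∷ [] ⟶ A

    ⊗L : ∀ {Γ F H G} → κ ∣ F ∷ H ∷ Γ ⟶ G → κ ∣ F ⊗ H ∷ Γ ⟶ G
    ⊗R : ∀ {Γ₁ Γ₂ F H} → κ ∣ Γ₁ ⟶ F → κ ∣ Γ₂ ⟶ H → κ ∣ Γ₁ ++ Γ₂ ⟶ F ⊗ H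

    𝟏L : ∀ {Γ G} → κ ∣ Γ ⟶ G → κ ∣ 𝟏 ∷ Γ ⟶ G
    𝟏R : κ ∣ [] ⟶ 𝟏

    ⊤R : ∀ {Γ} → κ ∣ Γ ⟶ ⊤

    ⊸L : ∀ {Γ₁ Γ₂ F H G} →
         κ ∣ Γ₁ ⟶ F → κ ∣ H ∷ Γ₂ ⟶ G → κ ∣ F ⊸ H ∷ Γ₁ ++ Γ₂ ⟶ G
    ⊸R : ∀ {Γ F H} → κ ∣ F ∷ Γ ⟶ H → κ ∣ Γ ⟶ F ⊸ H

    &L₁ : ∀ {Γ F₁ F₂ G} → κ ∣ F₁ ∷ Γ ⟶ G → κ ∣ F₁ & F₂ ∷ Γ ⟶ G
    &L₂ : ∀ {Γ F₁ F₂ G} → κ ∣ F₂ ∷ Γ ⟶ G → κ ∣ F₁ & F₂ ∷ Γ ⟶ G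
    &R  : ∀ {Γ F H} → κ ∣ Γ ⟶ F → κ ∣ Γ ⟶ H → κ ∣ Γ ⟶ F & H

    ∃L : ∀ {Γ F G} → κ ∣ F ∷ map shift Γ ⟶ shift G → κ ∣ ∃′ F ∷ Γ ⟶ G
    ∃R : ∀ {Γ G} (t : Term) → κ ∣ Γ ⟶ G [ t ] → κ ∣ Γ ⟶ ∃′ G

    ∀L : ∀ {Γ F G} (t : Term) → κ ∣ F [ t ] ∷ Γ ⟶ G → κ ∣ ∀′ F ∷ Γ ⟶ G
    ∀R : ∀ {Γ G} → κ ∣ map shift Γ ⟶ G → κ ∣ Γ ⟶ ∀′ G

    dereliction : ∀ {Γ a F G} → κ ∣ F ∷ Γ ⟶ G → κ ∣ ! a F ∷ Γ ⟶ G

    promotion : ∀ {a F} (Θ : List (Label × Formula)) → a ≤ ∏ (map proj₁ Θ) →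
                κ ∣ map bang Θ ⟶ F → κ ∣ map bang Θ ⟶ ! a F

    weakening   : ∀ {Γ b F G} → κ ∣ Γ ⟶ G → κ ∣ ! b F ∷ Γ ⟶ G
    contraction : ∀ {Γ b F G} → κ ∣ ! b F ∷ ! b F ∷ Γ ⟶ G → κ ∣ ! b F ∷ Γ ⟶ G

    cut : ∀ {Γ Δ G F} → κ ≡ with-cut →
          κ ∣ Γ ⟶ G → κ ∣ G ∷ Δ ⟶ F → κ ∣ Γ ++ Δ ⟶ F

{-# OPTIONS --safe #-}
module Submission where

-- The proof is semantic, after Okada.  A formula is interpreted as a set of
-- contexts closed under the double orthogonal with respect to cut-free
-- provability, where ⟦ ! a F ⟧ is generated by the contexts !^{a₁}F₁,…,!^{aₙ}Fₙ
-- in ⟦ F ⟧ with a ≤ a₁ × ⋯ × aₙ.  Derivations with cut are sound for this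
-- interpretation: cut is composition, and promotion holds because × is monotone
-- and the label of a concatenated context is the product of the labels.
-- Conversely the one-formula context F lies in ⟦ F ⟧, and every context in ⟦ F ⟧
-- proves F without cut.

open import Defs
open import Data.Empty using (⊥-elim)
open import Data.List.Base using (List; []; _∷_; _++_; map)
open import Data.List.Properties
  using (map-++; map-∘; map-cong; ++-identityʳ; ++-assoc; ∷-injectiveˡ; ∷-injectiveʳ)
open import Data.List.Relation.Binary.Permutation.Propositional
  using (_↭_; refl; prep; swap; trans; ↭-sym; ↭-reflexive; ↭-refl; ↭-trans)
open import Data.List.Relation.Binary.Permutation.Propositional.Properties
  using (map⁺; ++⁺ˡ; ++⁺ʳ; ++-comm; shifts)
open import Data.Nat.Base using (ℕ; zero; suc; _<_) renaming (_⊔_ to max)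
open import Data.Nat.Properties
  using (_≟_; <⇒≢; n<1+n; <-trans; m<n⇒m<n⊔o; m<n⇒m<o⊔n)
open import Data.Product.Base using (_×_; _,_; proj₁; proj₂; ∃; ∃₂; map₂)
open import Data.Unit.Polymorphic.Base using (tt) renaming (⊤ to Unit)
open import Data.Vec.Base using (Vec; []; _∷_)
open import Function.Base using (_∘_; id)
open import Level using (Level; _⊔_)
open import Relation.Binary.PropositionalEquality
  using (_≡_; _≗_; refl; sym; cong; cong₂; subst; subst₂; module ≡-Reasoning)
  renaming (trans to ≡-trans)
open import Relation.Nullary.Decidable.Core using (yes; no)
open import Relation.Unary using (Pred; _⊆_; _∩_; _≐_; ｛_｝)

module CutElimination {c f r : Level} (𝒜 : CSemiring c) (L : Language f r) where

  open CSemiring 𝒜 using (≤-refl; ≤-trans; *-mono-≤; *-assoc; *-identityˡ; *-identityʳ; _≤_)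
    renaming (Carrier to Label; _*_ to _*ᴬ_)
  open SELLS 𝒜 L
  open Language L

  -- Substitutions

  AgreeBelow : ℕ → Subst → Subst → Set f
  AgreeBelow n σ τ = ∀ {x} → x < n → σ x ≡ τ x

  mutual
    substTerm-support : ∀ t → ∃ λ n → ∀ {σ τ} → AgreeBelow n σ τ →
                        substTerm σ t ≡ substTerm τ t
    substTerm-support (var x)    = suc x , λ h → h (n<1+n x)
    substTerm-support (fun g ts) =
      let n , eq = substTerms-support ts in n , λ h → cong (fun g) (eq h)

    substTerms-support : ∀ {m} (ts : Vec Term m) → ∃ λ n → ∀ {σ τ} → AgreeBelow n σ τ →
                         substTerms σ ts ≡ substTerms τ ts
    substTerms-support []       = 0 , λ _ → refl
    substTerms-support (t ∷ ts) =
      let n₁ , eq₁ = substTerm-support t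
          n₂ , eq₂ = substTerms-support ts
      in max n₁ n₂ , λ h → cong₂ _∷_ (eq₁ (h ∘ m<n⇒m<n⊔o n₂)) (eq₂ (h ∘ m<n⇒m<o⊔n n₁))

  -- Lifting even yields agreement below `suc n`; settling for `n` lets `support` reuse the bound of
  -- a body for the quantified formula.
  lift-agreeBelow : ∀ {n σ τ} → AgreeBelow n σ τ → AgreeBelow n (lift σ) (lift τ)
  lift-agreeBelow h {zero}  _ = refl
  lift-agreeBelow h {suc x} p = cong (substTerm shiftVar) (h (<-trans (n<1+n x) p))

  -- A bound on the free variables, encoded by the action of substitutions instead of an occurrence
  -- relation.
  Supported : Formula → ℕ → Set (c ⊔ f ⊔ r)
  Supported F n = ∀ {σ τ} → AgreeBelow n σ τ → substFormula σ F ≡ substFormula τ F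

  supported₂ : ∀ {_∙_ : Formula → Formula → Formula} {F H} →
               (∀ σ → substFormula σ (F ∙ H) ≡ substFormula σ F ∙ substFormula σ H) →
               ∃ (Supported F) → ∃ (Supported H) → ∃ (Supported (F ∙ H))
  supported₂ {_∙_} dist (n₁ , eq₁) (n₂ , eq₂) = max n₁ n₂ , λ h →
    ≡-trans (dist _) (≡-trans
      (cong₂ _∙_ (eq₁ (h ∘ m<n⇒m<n⊔o n₂)) (eq₂ (h ∘ m<n⇒m<o⊔n n₁))) (sym (dist _)))

  support : ∀ F → ∃ (Supported F)
  support (atom p ts) = let n , eq = substTerms-support ts in n , λ h → cong (atom p) (eq h)
  support (F ⊗ H) = supported₂ {_⊗_} (λ _ → refl) (support F) (support H)
  support (F ⊸ H) = supported₂ {_⊸_} (λ _ → refl) (support F) (support H)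
  support (F & H) = supported₂ {_&_} (λ _ → refl) (support F) (support H)
  support 𝟏       = 0 , λ _ → refl
  support ⊤       = 0 , λ _ → refl
  support (∃′ F)  = let n , eq = support F in n , λ h → cong ∃′ (eq (lift-agreeBelow h))
  support (∀′ F)  = let n , eq = support F in n , λ h → cong ∀′ (eq (lift-agreeBelow h))
  support (! a F) = let n , eq = support F in n , λ h → cong (! a) (eq h)

  support* : ∀ Γ → ∃ λ n → ∀ {σ τ} → AgreeBelow n σ τ →
             map (substFormula σ) Γ ≡ map (substFormula τ) Γ
  support* []      = 0 , λ _ → refl
  support* (F ∷ Γ) =
    let n₁ , eq₁ = support F
        n₂ , eq₂ = support* Γ
    in max n₁ n₂ , λ h → cong₂ _∷_ (eq₁ (h ∘ m<n⇒m<n⊔o n₂)) (eq₂ (h ∘ m<n⇒m<o⊔n n₁))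

  substFormula-cong : ∀ {σ τ} → σ ≗ τ → substFormula σ ≗ substFormula τ
  substFormula-cong h F = proj₂ (support F) (λ _ → h _)

  mutual
    substTerm-∘ : ∀ {σ τ υ} → substTerm τ ∘ σ ≗ υ → substTerm τ ∘ substTerm σ ≗ substTerm υ
    substTerm-∘ h (var x)    = h x
    substTerm-∘ h (fun g ts) = cong (fun g) (substTerms-∘ h ts)

    substTerms-∘ : ∀ {σ τ υ m} → substTerm τ ∘ σ ≗ υ →
                   substTerms {m} τ ∘ substTerms σ ≗ substTerms υ
    substTerms-∘ h []       = refl
    substTerms-∘ h (t ∷ ts) = cong₂ _∷_ (substTerm-∘ h t) (substTerms-∘ h ts)

  mutual
    substTerm-var : ∀ t → substTerm var t ≡ t
    substTerm-var (var x)    = refl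
    substTerm-var (fun g ts) = cong (fun g) (substTerms-var ts)

    substTerms-var : ∀ {m} (ts : Vec Term m) → substTerms var ts ≡ ts
    substTerms-var []       = refl
    substTerms-var (t ∷ ts) = cong₂ _∷_ (substTerm-var t) (substTerms-var ts)

  lift-∘ : ∀ {σ τ υ} → substTerm τ ∘ σ ≗ υ → substTerm (lift τ) ∘ lift σ ≗ lift υ
  lift-∘ h zero = refl
  lift-∘ {σ} {τ} {υ} h (suc x) = begin
    substTerm (lift τ) (substTerm shiftVar (σ x))  ≡⟨ substTerm-∘ (λ _ → refl) (σ x) ⟩
    substTerm (substTerm shiftVar ∘ τ) (σ x)       ≡⟨ substTerm-∘ (λ _ → refl) (σ x) ⟨
    substTerm shiftVar (substTerm τ (σ x))         ≡⟨ cong (substTerm shiftVar) (h x) ⟩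
    substTerm shiftVar (υ x)                       ∎
    where open ≡-Reasoning

  -- The composite is a third substitution given by a pointwise equation: under a binder, `lift-∘`
  -- supplies the equation for the body without function extensionality.
  substFormula-∘ : ∀ {σ τ υ} → substTerm τ ∘ σ ≗ υ →
                   substFormula τ ∘ substFormula σ ≗ substFormula υ
  substFormula-∘ h (atom p ts) = cong (atom p) (substTerms-∘ h ts)
  substFormula-∘ h (F ⊗ H)     = cong₂ _⊗_ (substFormula-∘ h F) (substFormula-∘ h H)
  substFormula-∘ h (F ⊸ H)     = cong₂ _⊸_ (substFormula-∘ h F) (substFormula-∘ h H)
  substFormula-∘ h (F & H)     = cong₂ _&_ (substFormula-∘ h F) (substFormula-∘ h H)
  substFormula-∘ h 𝟏           = refl
  substFormula-∘ h ⊤           = refl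
  substFormula-∘ h (∃′ F)      = cong ∃′ (substFormula-∘ (lift-∘ h) F)
  substFormula-∘ h (∀′ F)      = cong ∀′ (substFormula-∘ (lift-∘ h) F)
  substFormula-∘ h (! a F)     = cong (! a) (substFormula-∘ h F)

  lift-var : lift var ≗ var
  lift-var zero    = refl
  lift-var (suc x) = refl

  substFormula-var : substFormula var ≗ id
  substFormula-var (atom p ts) = cong (atom p) (substTerms-var ts)
  substFormula-var (F ⊗ H)     = cong₂ _⊗_ (substFormula-var F) (substFormula-var H)
  substFormula-var (F ⊸ H)     = cong₂ _⊸_ (substFormula-var F) (substFormula-var H)
  substFormula-var (F & H)     = cong₂ _&_ (substFormula-var F) (substFormula-var H)
  substFormula-var 𝟏           = refl
  substFormula-var ⊤           = refl
  substFormula-var (∃′ F)      =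
    cong ∃′ (≡-trans (substFormula-cong lift-var F) (substFormula-var F))
  substFormula-var (∀′ F)      =
    cong ∀′ (≡-trans (substFormula-cong lift-var F) (substFormula-var F))
  substFormula-var (! a F)     = cong (! a) (substFormula-var F)

  infixr 5 _∷ₛ_
  _∷ₛ_ : Term → Subst → Subst
  (t ∷ₛ σ) zero    = t
  (t ∷ₛ σ) (suc x) = σ x

  inst-∘-lift : ∀ t σ → substTerm (instVar t) ∘ lift σ ≗ t ∷ₛ σ
  inst-∘-lift t σ zero    = refl
  inst-∘-lift t σ (suc x) = ≡-trans (substTerm-∘ (λ _ → refl) (σ x)) (substTerm-var (σ x))

  ∷ₛ-∘-inst : ∀ t σ → substTerm σ ∘ instVar t ≗ substTerm σ t ∷ₛ σ
  ∷ₛ-∘-inst t σ zero    = refl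
  ∷ₛ-∘-inst t σ (suc x) = refl

  lift-inst : ∀ t σ F → substFormula (lift σ) F [ t ] ≡ substFormula (t ∷ₛ σ) F
  lift-inst t σ = substFormula-∘ (inst-∘-lift t σ)

  subst-inst : ∀ t σ F → substFormula σ (F [ t ]) ≡ substFormula (lift σ) F [ substTerm σ t ]
  subst-inst t σ F =
    ≡-trans (substFormula-∘ (∷ₛ-∘-inst t σ) F) (sym (lift-inst (substTerm σ t) σ F))

  subst-shift : ∀ σ → substFormula (lift σ) ∘ shift ≗ shift ∘ substFormula σ
  subst-shift σ F =
    ≡-trans (substFormula-∘ (λ _ → refl) F) (sym (substFormula-∘ (λ _ → refl) F))

  subst-map-shift : ∀ σ Γ → map (substFormula (lift σ)) (map shift Γ) ≡
                            map shift (map (substFormula σ) Γ)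
  subst-map-shift σ Γ =
    ≡-trans (sym (map-∘ Γ)) (≡-trans (map-cong (subst-shift σ) Γ) (map-∘ Γ))

  subst-map-bang : ∀ σ Θ → map (substFormula σ) (map bang Θ) ≡
                           map bang (map (map₂ (substFormula σ)) Θ)
  subst-map-bang σ Θ = ≡-trans (sym (map-∘ Θ)) (map-∘ Θ)

  -- Cut-free provability

  Ctx : Set (c ⊔ f ⊔ r)
  Ctx = List Formula

  infix 3 _⊢_
  _⊢_ : Ctx → Formula → Set (c ⊔ f ⊔ r)
  Γ ⊢ G = cut-free ∣ Γ ⟶ G

  -- Serves to rename a fresh variable into an eigenvariable. Promotion survives because
  -- substitution leaves the labels alone.
  ⊢-subst : ∀ {Γ G} σ → Γ ⊢ G → map (substFormula σ) Γ ⊢ substFormula σ G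
  ⊢-subst σ (exchange p d) = exchange (map⁺ _ p) (⊢-subst σ d)
  ⊢-subst σ initial        = initial
  ⊢-subst σ (⊗L d)         = ⊗L (⊢-subst σ d)
  ⊢-subst σ (⊗R {Γ₁} {Γ₂} d e) =
    subst (_⊢ _) (sym (map-++ _ Γ₁ Γ₂)) (⊗R (⊢-subst σ d) (⊢-subst σ e))
  ⊢-subst σ (𝟏L d) = 𝟏L (⊢-subst σ d)
  ⊢-subst σ 𝟏R     = 𝟏R
  ⊢-subst σ ⊤R     = ⊤R
  ⊢-subst σ (⊸L {Γ₁} {Γ₂} d e) =
    subst (λ Γ → _ ∷ Γ ⊢ _) (sym (map-++ _ Γ₁ Γ₂)) (⊸L (⊢-subst σ d) (⊢-subst σ e))
  ⊢-subst σ (⊸R d)   = ⊸R (⊢-subst σ d)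
  ⊢-subst σ (&L₁ d)  = &L₁ (⊢-subst σ d)
  ⊢-subst σ (&L₂ d)  = &L₂ (⊢-subst σ d)
  ⊢-subst σ (&R d e) = &R (⊢-subst σ d) (⊢-subst σ e)
  ⊢-subst σ (∃L {Γ} {G = G} d) =
    ∃L (subst₂ _⊢_ (cong (_ ∷_) (subst-map-shift σ Γ)) (subst-shift σ G) (⊢-subst (lift σ) d))
  ⊢-subst σ (∃R {G = G} t d) =
    ∃R (substTerm σ t) (subst (_ ⊢_) (subst-inst t σ G) (⊢-subst σ d))
  ⊢-subst σ (∀L {F = F} t d) =
    ∀L (substTerm σ t) (subst (λ H → H ∷ _ ⊢ _) (subst-inst t σ F) (⊢-subst σ d))
  ⊢-subst σ (∀R {Γ} d) = ∀R (subst (_⊢ _) (subst-map-shift σ Γ) (⊢-subst (lift σ) d))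
  ⊢-subst σ (dereliction d) = dereliction (⊢-subst σ d)
  ⊢-subst σ (promotion Θ a≤ d) =
    subst (_⊢ _) (sym (subst-map-bang σ Θ))
      (promotion (map (map₂ (substFormula σ)) Θ)
        (subst (λ ls → _ ≤ ∏ ls) (map-∘ Θ) a≤)
        (subst (_⊢ _) (subst-map-bang σ Θ) (⊢-subst σ d)))
  ⊢-subst σ (weakening d)   = weakening (⊢-subst σ d)
  ⊢-subst σ (contraction d) = contraction (⊢-subst σ d)
  ⊢-subst σ (cut () d e)

  -- Binds the free variable `n`: on formulas supported below `n` it acts as `shift`, and from
  -- `F [ var n ]` it recovers the body `F`. These are the shapes found in the premises of `∀R` and
  -- `∃L`.
  capture : ℕ → Subst
  capture n x with x ≟ n
  ... | yes _ = var zero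
  ... | no  _ = var (suc x)

  capture-≡ : ∀ n → capture n n ≡ var zero
  capture-≡ n with n ≟ n
  ... | yes _   = refl
  ... | no  n≢n = ⊥-elim (n≢n refl)

  capture-< : ∀ n → AgreeBelow n (capture n) shiftVar
  capture-< n {x} x<n with x ≟ n
  ... | yes x≡n = ⊥-elim (<⇒≢ x<n x≡n)
  ... | no  _   = refl

  -- Below `n` the composite substitution is the identity: index 0 goes to `var n` and back, while
  -- `suc x` drops to `x`, which is below `n` and hence shifted up again.
  capture-body : ∀ {n F} → Supported F n → substFormula (capture n) (F [ var n ]) ≡ F
  capture-body {n} {F} eq =
    ≡-trans (substFormula-∘ (λ _ → refl) F) (≡-trans (eq agree) (substFormula-var F))
    where
    agree : AgreeBelow n (substTerm (capture n) ∘ instVar (var n)) var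
    agree {zero}  _ = capture-≡ n
    agree {suc x} p = capture-< n (<-trans (n<1+n x) p)

  -- An eigenvariable can be any variable beyond the support of the sequent, so
  -- the quantifier rules also hold with one premise for each term.
  ∀R-terms : ∀ {Γ F} → (∀ t → Γ ⊢ F [ t ]) → Γ ⊢ ∀′ F
  ∀R-terms {Γ} {F} d with support* Γ | support F
  ... | n₁ , eq₁ | n₂ , eq₂ =
    ∀R (subst₂ _⊢_ (eq₁ (capture-< n ∘ m<n⇒m<n⊔o n₂))
                   (capture-body (λ h → eq₂ (h ∘ m<n⇒m<o⊔n n₁)))
                   (⊢-subst (capture n) (d (var n))))
    where n = max n₁ n₂

  ∃L-terms : ∀ {Γ F G} → (∀ t → F [ t ] ∷ Γ ⊢ G) → ∃′ F ∷ Γ ⊢ G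
  -- The conclusion joins the context so that one bound makes the variable fresh for both.
  ∃L-terms {Γ} {F} {G} d with support* (G ∷ Γ) | support F
  ... | n₁ , eq₁ | n₂ , eq₂ =
    ∃L (subst₂ _⊢_ (cong₂ _∷_ (capture-body (λ h → eq₂ (h ∘ m<n⇒m<o⊔n n₁))) (∷-injectiveʳ eq))
                   (∷-injectiveˡ eq)
                   (⊢-subst (capture n) (d (var n))))
    where
    n = max n₁ n₂
    eq : map (substFormula (capture n)) (G ∷ Γ) ≡ map shift (G ∷ Γ)
    eq = eq₁ (capture-< n ∘ m<n⇒m<n⊔o n₂)

  weaken* : ∀ {Δ C} Θ → Δ ⊢ C → map bang Θ ++ Δ ⊢ C
  weaken* []      d = d
  weaken* (_ ∷ Θ) d = weakening (weaken* Θ d)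

  contract* : ∀ {Δ C} Θ → map bang Θ ++ map bang Θ ++ Δ ⊢ C → map bang Θ ++ Δ ⊢ C
  contract* []      d = d
  contract* {Δ} (x ∷ Θ) d =
    -- Once contracted, the head moves behind both copies of the tail and counts as part of `Δ` in
    -- the recursive call.
    exchange (shift-∷ Θs)
      (contract* Θ
        (exchange (↭-trans (↭-sym (shift-∷ Θs)) (++⁺ˡ Θs (↭-sym (shift-∷ Θs))))
          (contraction (exchange (prep _ (shift-∷ Θs)) d))))
    where
    Θs = map bang Θ
    shift-∷ : ∀ Γ {Δ} → Γ ++ bang x ∷ Δ ↭ bang x ∷ Γ ++ Δ
    shift-∷ Γ = shifts Γ (bang x ∷ [])

  -- Phase semantics

  Phase : Set _
  Phase = Pred Ctx (c ⊔ f ⊔ r)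

  -- The tests are pairs of a side context and a conclusion. The premise says that the test passes
  -- on all of `X`, so `cl X` is the biorthogonal, in continuation form.
  cl : Phase → Phase
  cl X Γ = ∀ {Δ C} → (∀ {Γ′} → X Γ′ → Γ′ ++ Δ ⊢ C) → Γ ++ Δ ⊢ C

  Closed : Phase → Set (c ⊔ f ⊔ r)
  Closed X = cl X ⊆ X

  infixr 8 _∗_
  infixr 6 _⇾_
  _∗_ _⇾_ : Phase → Phase → Phase
  (X ∗ Y) Γ = ∃₂ λ Γ₁ Γ₂ → Γ ↭ Γ₁ ++ Γ₂ × X Γ₁ × Y Γ₂
  (X ⇾ Y) Γ = ∀ {Γ′} → X Γ′ → Y (Γ′ ++ Γ)

  Promoted : Label → Phase → Phase
  Promoted a X Γ = ∃ λ Θ → Γ ≡ map bang Θ × a ≤ ∏ (map proj₁ Θ) × X Γ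

  η : ∀ {X} → X ⊆ cl X
  η x k = k x

  cl-mono : ∀ {X Y} → X ⊆ Y → cl X ⊆ cl Y
  cl-mono f h k = h (λ x → k (f x))

  cl-closed : ∀ {X} → Closed (cl X)
  cl-closed h k = h (λ x → x k)

  -- Membership in a closed set is decided by tests, so a left rule valid for every side context and
  -- conclusion acts on the set itself.
  closed-rule : ∀ {X Γ Γ′} → Closed X → (∀ {Δ C} → Γ ++ Δ ⊢ C → Γ′ ++ Δ ⊢ C) → X Γ → X Γ′
  closed-rule cX R x = cX (λ k → R (k x))

  closed-↭ : ∀ {X Γ Γ′} → Closed X → Γ ↭ Γ′ → X Γ → X Γ′
  closed-↭ cX p = closed-rule cX (exchange (++⁺ʳ _ p))

  -- Towards a closed goal, an element of a closure may be replaced by a generator; `Δ` is absorbed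
  -- into the side context of the test.
  bind : ∀ {X Y Γ Δ} → Closed Y → cl X Γ → (∀ {Γ′} → X Γ′ → Y (Γ′ ++ Δ)) → Y (Γ ++ Δ)
  bind {Γ = Γ} {Δ} cY x f = cY λ k →
    subst (_⊢ _) (sym (++-assoc Γ Δ _))
      (x λ {Γ′} x′ → subst (_⊢ _) (++-assoc Γ′ Δ _) (k (f x′)))

  ⇾-closed : ∀ {X Y} → Closed Y → Closed (X ⇾ Y)
  ⇾-closed {X} {Y} cY {Γ} h {Γ′} x =
    closed-↭ cY (++-comm Γ Γ′)
      (bind {X ⇾ Y} cY h λ {Γ″} k → closed-↭ cY (++-comm Γ′ Γ″) (k x))

  -- The empty side context with conclusion `G` is itself a test, passed by every member.
  ⊢-closed : ∀ {G} → Closed (_⊢ G)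
  ⊢-closed {G} {Γ} h = subst (_⊢ G) (++-identityʳ Γ)
    (h λ {Γ′} d → subst (_⊢ G) (sym (++-identityʳ Γ′)) d)

  -- Closure is taken at `⊗`, `𝟏`, `∃′` and `!`; the other clauses give closed sets directly. The
  -- environment records the terms chosen for the quantifiers.
  ⟦_⟧ : Formula → Subst → Phase
  ⟦ atom p ts ⟧ ρ = _⊢ atom p (substTerms ρ ts)
  ⟦ F ⊗ H ⟧     ρ = cl (⟦ F ⟧ ρ ∗ ⟦ H ⟧ ρ)
  ⟦ F ⊸ H ⟧     ρ = ⟦ F ⟧ ρ ⇾ ⟦ H ⟧ ρ
  ⟦ F & H ⟧     ρ = ⟦ F ⟧ ρ ∩ ⟦ H ⟧ ρ
  ⟦ 𝟏 ⟧         ρ = cl ｛ [] ｝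
  ⟦ ⊤ ⟧         ρ = λ _ → Unit
  ⟦ ∃′ F ⟧      ρ = cl (λ Γ → ∃ λ t → ⟦ F ⟧ (t ∷ₛ ρ) Γ)
  ⟦ ∀′ F ⟧      ρ = λ Γ → ∀ t → ⟦ F ⟧ (t ∷ₛ ρ) Γ
  ⟦ ! a F ⟧     ρ = cl (Promoted a (⟦ F ⟧ ρ))

  -- Left unclosed, so that `sound` can split a context by pattern matching.
  ⟦_⟧* : Ctx → Subst → Phase
  ⟦ [] ⟧*    ρ = ｛ [] ｝
  ⟦ F ∷ Γ ⟧* ρ = ⟦ F ⟧ ρ ∗ ⟦ Γ ⟧* ρ

  ⟦⟧-closed : ∀ F ρ → Closed (⟦ F ⟧ ρ)
  ⟦⟧-closed (atom p ts) ρ = ⊢-closed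
  ⟦⟧-closed (F ⊗ H)     ρ = cl-closed {⟦ F ⟧ ρ ∗ ⟦ H ⟧ ρ}
  ⟦⟧-closed (F ⊸ H)     ρ = ⇾-closed {⟦ F ⟧ ρ} (⟦⟧-closed H ρ)
  ⟦⟧-closed (F & H)     ρ h =
    ⟦⟧-closed F ρ (cl-mono proj₁ h) , ⟦⟧-closed H ρ (cl-mono proj₂ h)
  ⟦⟧-closed 𝟏           ρ = cl-closed {｛ [] ｝}
  ⟦⟧-closed ⊤           ρ = _
  ⟦⟧-closed (∃′ F)      ρ = cl-closed {λ Γ → ∃ λ t → ⟦ F ⟧ (t ∷ₛ ρ) Γ}
  ⟦⟧-closed (∀′ F)      ρ h t = ⟦⟧-closed F (t ∷ₛ ρ) (cl-mono (λ k → k t) h)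
  ⟦⟧-closed (! a F)     ρ = cl-closed {Promoted a (⟦ F ⟧ ρ)}

  ∗-mono : ∀ {X X′ Y Y′ : Phase} → X ⊆ X′ → Y ⊆ Y′ → X ∗ Y ⊆ X′ ∗ Y′
  ∗-mono f g (Γ₁ , Γ₂ , p , x , y) = Γ₁ , Γ₂ , p , f x , g y

  ∷ₛ-∘-lift : ∀ {σ ρ υ} t → substTerm ρ ∘ σ ≗ υ → substTerm (t ∷ₛ ρ) ∘ lift σ ≗ t ∷ₛ υ
  ∷ₛ-∘-lift     t h zero    = refl
  ∷ₛ-∘-lift {σ} t h (suc x) = ≡-trans (substTerm-∘ (λ _ → refl) (σ x)) (h x)

  -- Both inclusions are proved at once because `⊸` is contravariant on its left.
  ⟦⟧-subst : ∀ F {σ ρ υ} → substTerm ρ ∘ σ ≗ υ → ⟦ substFormula σ F ⟧ ρ ≐ ⟦ F ⟧ υ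
  ⟦⟧-subst (atom p ts) h =
    subst (λ us → _ ⊢ atom p us) (substTerms-∘ h ts) ,
    subst (λ us → _ ⊢ atom p us) (sym (substTerms-∘ h ts))
  ⟦⟧-subst (F ⊗ H) h =
    let F⊆ , F⊇ = ⟦⟧-subst F h
        H⊆ , H⊇ = ⟦⟧-subst H h
    in cl-mono (∗-mono F⊆ H⊆) , cl-mono (∗-mono F⊇ H⊇)
  ⟦⟧-subst (F ⊸ H) h =
    let F⊆ , F⊇ = ⟦⟧-subst F h
        H⊆ , H⊇ = ⟦⟧-subst H h
    in (λ k x → H⊆ (k (F⊇ x))) , (λ k x → H⊇ (k (F⊆ x)))
  ⟦⟧-subst (F & H) h =
    let F⊆ , F⊇ = ⟦⟧-subst F h
        H⊆ , H⊇ = ⟦⟧-subst H h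
    in (λ (x , y) → F⊆ x , H⊆ y) , (λ (x , y) → F⊇ x , H⊇ y)
  ⟦⟧-subst 𝟏 h = (λ x → x) , (λ x → x)
  ⟦⟧-subst ⊤ h = _
  ⟦⟧-subst (∃′ F) h =
    cl-mono (λ (t , x) → t , proj₁ (⟦⟧-subst F (∷ₛ-∘-lift t h)) x) ,
    cl-mono (λ (t , x) → t , proj₂ (⟦⟧-subst F (∷ₛ-∘-lift t h)) x)
  ⟦⟧-subst (∀′ F) h =
    (λ k t → proj₁ (⟦⟧-subst F (∷ₛ-∘-lift t h)) (k t)) ,
    (λ k t → proj₂ (⟦⟧-subst F (∷ₛ-∘-lift t h)) (k t))
  ⟦⟧-subst (! a F) h =
    let F⊆ , F⊇ = ⟦⟧-subst F h
    in cl-mono (map₂ (map₂ (map₂ F⊆))) , cl-mono (map₂ (map₂ (map₂ F⊇)))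

  ⟦⟧-shift : ∀ F t ρ → ⟦ shift F ⟧ (t ∷ₛ ρ) ≐ ⟦ F ⟧ ρ
  ⟦⟧-shift F t ρ = ⟦⟧-subst F (λ _ → refl)

  ⟦⟧*-shift : ∀ Γ t ρ → ⟦ Γ ⟧* ρ ⊆ ⟦ map shift Γ ⟧* (t ∷ₛ ρ)
  ⟦⟧*-shift []      t ρ = id
  ⟦⟧*-shift (F ∷ Γ) t ρ = ∗-mono (proj₂ (⟦⟧-shift F t ρ)) (⟦⟧*-shift Γ t ρ)

  ⟦⟧-inst : ∀ F t ρ → ⟦ F [ t ] ⟧ ρ ≐ ⟦ F ⟧ (substTerm ρ t ∷ₛ ρ)
  ⟦⟧-inst F t ρ = ⟦⟧-subst F (∷ₛ-∘-inst t ρ)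

  ⟦⟧*-↭ : ∀ {Γ Δ} ρ → Γ ↭ Δ → ⟦ Γ ⟧* ρ ⊆ ⟦ Δ ⟧* ρ
  ⟦⟧*-↭ ρ refl        = id
  ⟦⟧*-↭ ρ (prep F p)  = ∗-mono id (⟦⟧*-↭ ρ p)
  ⟦⟧*-↭ ρ (swap F H p) (Γ₁ , _ , q , x , Γ₂ , Γ₃ , q′ , y , z) =
    Γ₂ , Γ₁ ++ Γ₃ , ↭-trans q (↭-trans (++⁺ˡ Γ₁ q′) (shifts Γ₁ Γ₂)) , y ,
    Γ₁ , Γ₃ , ↭-refl , x , ⟦⟧*-↭ ρ p z
  ⟦⟧*-↭ ρ (trans p q) = ⟦⟧*-↭ ρ q ∘ ⟦⟧*-↭ ρ p

  ⟦⟧*-++ : ∀ Γ {Δ} ρ → ⟦ Γ ++ Δ ⟧* ρ ⊆ ⟦ Γ ⟧* ρ ∗ ⟦ Δ ⟧* ρ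
  ⟦⟧*-++ []      ρ y = [] , _ , ↭-refl , refl , y
  ⟦⟧*-++ (F ∷ Γ) ρ (Γ₁ , _ , p , x , z) with ⟦⟧*-++ Γ ρ z
  ... | Γ₂ , Γ₃ , q , y , y′ =
    Γ₁ ++ Γ₂ , Γ₃ , ↭-trans p (↭-trans (++⁺ˡ Γ₁ q) (↭-reflexive (sym (++-assoc Γ₁ Γ₂ Γ₃)))) ,
    (Γ₁ , Γ₂ , ↭-refl , x , y) , y′

  -- Promotion and soundness

  ∏-++ : ∀ ls ms → ∏ (ls ++ ms) ≡ ∏ ls *ᴬ ∏ ms
  ∏-++ []       ms = sym (*-identityˡ _)
  ∏-++ (l ∷ ls) ms = ≡-trans (cong (l *ᴬ_) (∏-++ ls ms)) (sym (*-assoc l _ _))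

  Promoted-∗ : ∀ {a b} {X Y : Phase} → Promoted a X ∗ Promoted b Y ⊆ cl (Promoted (a *ᴬ b) (X ∗ Y))
  Promoted-∗ {a} {b} {X} {Y} (_ , _ , p , (Θ₁ , refl , a≤ , x) , (Θ₂ , refl , b≤ , y)) =
    closed-↭ (cl-closed {Promoted (a *ᴬ b) (X ∗ Y)}) (↭-sym p)
      (η ( Θ₁ ++ Θ₂
         , sym (map-++ bang Θ₁ Θ₂)
         , subst (a *ᴬ b ≤_)
             (≡-trans (sym (∏-++ (map proj₁ Θ₁) _)) (cong ∏ (sym (map-++ proj₁ Θ₁ Θ₂))))
             (*-mono-≤ a≤ b≤)
         , _ , _ , ↭-refl , x , y))

  -- The factors are replaced by generators one at a time; as `bind` acts on the left part,
  -- commutativity brings the second factor to the front.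
  cl-∗ : ∀ {X Y} → cl X ∗ cl Y ⊆ cl (X ∗ Y)
  cl-∗ {X} {Y} (Γ₁ , Γ₂ , p , x , y) =
    closed-↭ (cl-closed {X ∗ Y}) (↭-sym p)
      (bind (cl-closed {X ∗ Y}) x λ {Γ₁′} x′ →
        closed-↭ (cl-closed {X ∗ Y}) (++-comm Γ₂ Γ₁′)
          (bind (cl-closed {X ∗ Y}) y λ {Γ₂′} y′ →
            η (Γ₁′ , Γ₂′ , ++-comm Γ₂′ Γ₁′ , x′ , y′)))

  -- The semantic promotion rule: a resource for map bang Θ may be taken to be a
  -- context of banged formulas whose labels multiply to at least those of Θ.
  ⟦bang⟧* : ∀ Θ ρ → ⟦ map bang Θ ⟧* ρ ⊆ cl (Promoted (∏ (map proj₁ Θ)) (⟦ map bang Θ ⟧* ρ))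
  ⟦bang⟧* []            ρ refl = η ([] , refl , ≤-refl , refl)
  ⟦bang⟧* ((a , F) ∷ Θ) ρ h =
    cl-closed {Promoted (∏ (a ∷ map proj₁ Θ)) (⟦ bang (a , F) ⟧ ρ ∗ ⟦ map bang Θ ⟧* ρ)}
      (cl-mono (Promoted-∗ {X = ⟦ bang (a , F) ⟧ ρ} {Y = ⟦ map bang Θ ⟧* ρ})
        (cl-∗ (∗-mono ⟦!⟧-promoted (⟦bang⟧* Θ ρ) h)))
    where
    -- Semantic digging: a generator lies in the closure it generates, so its own list `Θ′`
    -- witnesses both layers.
    ⟦!⟧-promoted : ⟦ ! a F ⟧ ρ ⊆ cl (Promoted a (⟦ ! a F ⟧ ρ))
    ⟦!⟧-promoted = cl-mono λ x@(Θ′ , eq , a≤ , _) → Θ′ , eq , a≤ , η x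

  sound : ∀ {κ Γ G} → κ ∣ Γ ⟶ G → ∀ ρ → ⟦ Γ ⟧* ρ ⊆ ⟦ G ⟧ ρ
  sound (exchange p d) ρ γ = sound d ρ (⟦⟧*-↭ ρ (↭-sym p) γ)
  sound (initial {A}) ρ (Γ₁ , _ , p , x , refl) =
    closed-↭ (⟦⟧-closed A ρ) (↭-sym (↭-trans p (↭-reflexive (++-identityʳ Γ₁)))) x
  sound (⊗L {F = F} {H} {G} d) ρ (_ , Γ₂ , p , x , y) =
    closed-↭ (⟦⟧-closed G ρ) (↭-sym p)
      (bind {⟦ F ⟧ ρ ∗ ⟦ H ⟧ ρ} (⟦⟧-closed G ρ) x λ (Γ₃ , Γ₄ , q , x₁ , x₂) → sound d ρ
        ( Γ₃ , Γ₄ ++ Γ₂ , ↭-trans (++⁺ʳ Γ₂ q) (↭-reflexive (++-assoc Γ₃ Γ₄ Γ₂)) , x₁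
        , Γ₄ , Γ₂ , ↭-refl , x₂ , y))
  sound (⊗R {Γ₁} d e) ρ γ = η (∗-mono (sound d ρ) (sound e ρ) (⟦⟧*-++ Γ₁ ρ γ))
  sound (𝟏L {G = G} d) ρ (_ , _ , p , x , y) =
    closed-↭ (⟦⟧-closed G ρ) (↭-sym p)
      (bind {｛ [] ｝} (⟦⟧-closed G ρ) x λ { refl → sound d ρ y })
  sound 𝟏R ρ refl = η refl
  sound ⊤R ρ γ = tt
  sound (⊸L {Γ₁} {G = G} d e) ρ (Δ , _ , p , x , z) with ⟦⟧*-++ Γ₁ ρ z
  ... | Δ₁ , Δ₂ , q , z₁ , z₂ =
    sound e ρ ( Δ₁ ++ Δ , Δ₂ , ↭-trans p (↭-trans (++⁺ˡ Δ q) (↭-trans (shifts Δ Δ₁)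
                  (↭-reflexive (sym (++-assoc Δ₁ Δ Δ₂)))))
              , x (sound d ρ z₁) , z₂)
  sound (⊸R d) ρ γ x = sound d ρ (_ , _ , ↭-refl , x , γ)
  sound (&L₁ d) ρ γ = sound d ρ (∗-mono proj₁ id γ)
  sound (&L₂ d) ρ γ = sound d ρ (∗-mono proj₂ id γ)
  sound (&R d e) ρ γ = sound d ρ γ , sound e ρ γ
  sound (∃L {Γ} {F} {G} d) ρ (_ , Γ₂ , p , x , y) =
    closed-↭ (⟦⟧-closed G ρ) (↭-sym p)
      (bind {λ Γ → ∃ λ t → ⟦ F ⟧ (t ∷ₛ ρ) Γ} (⟦⟧-closed G ρ) x λ (t , x′) →
        proj₁ (⟦⟧-shift G t ρ)
          (sound d (t ∷ₛ ρ) (_ , Γ₂ , ↭-refl , x′ , ⟦⟧*-shift Γ t ρ y)))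
  sound (∃R {G = G} t d) ρ γ = η (substTerm ρ t , proj₁ (⟦⟧-inst G t ρ) (sound d ρ γ))
  sound (∀L {F = F} t d) ρ γ =
    sound d ρ (∗-mono (λ x → proj₂ (⟦⟧-inst F t ρ) (x (substTerm ρ t))) id γ)
  sound (∀R {Γ} d) ρ γ t = sound d (t ∷ₛ ρ) (⟦⟧*-shift Γ t ρ γ)
  sound (dereliction {F = F} d) ρ γ =
    sound d ρ (∗-mono (⟦⟧-closed F ρ ∘ cl-mono (proj₂ ∘ proj₂ ∘ proj₂)) id γ)
  sound (promotion Θ a≤ d) ρ γ =
    -- The label `a` is below the product for `Θ`, which is below the product for `Θ′`, so the
    -- conclusion is promoted along `Θ′`.
    cl-mono (λ (Θ′ , eq , ≤Θ′ , x) → Θ′ , eq , ≤-trans a≤ ≤Θ′ , sound d ρ x) (⟦bang⟧* Θ ρ γ)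
  sound (weakening {b = b} {F} {G} d) ρ (_ , _ , p , x , y) =
    closed-↭ (⟦⟧-closed G ρ) (↭-sym p)
      -- A generator consists of banged formulas only, so it can be weakened away inside the test
      -- sequent.
      (bind {Promoted b (⟦ F ⟧ ρ)} (⟦⟧-closed G ρ) x λ { (Θ , refl , _) →
        closed-rule (⟦⟧-closed G ρ)
          (λ e → subst (_⊢ _) (sym (++-assoc (map bang Θ) _ _)) (weaken* Θ e)) (sound d ρ y) })
  sound (contraction {b = b} {F} {G} d) ρ (_ , Γ₂ , p , x , y) =
    closed-↭ (⟦⟧-closed G ρ) (↭-sym p)
      (bind {Promoted b (⟦ F ⟧ ρ)} (⟦⟧-closed G ρ) x λ { x′@(Θ , refl , _) →
        closed-rule {Γ = map bang Θ ++ map bang Θ ++ Γ₂} (⟦⟧-closed G ρ)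
          (λ e → subst (_⊢ _) (sym (++-assoc (map bang Θ) _ _)) (contract* Θ
                   (subst (_⊢ _) (≡-trans (++-assoc (map bang Θ) _ _)
                                          (cong (map bang Θ ++_) (++-assoc (map bang Θ) _ _))) e)))
          -- One generator serves as both copies of the hypothesis; its formulas are then
          -- contracted.
          (sound d ρ (_ , _ , ↭-refl , η x′ , _ , _ , ↭-refl , η x′ , y)) })
  sound (cut {Γ} _ d e) ρ γ = sound e ρ (∗-mono (sound d ρ) id (⟦⟧*-++ Γ ρ γ))

  -- Reflection and reification

  mutual
    -- Each case is the left rule of the connective, applied inside a test. For `⊸` the argument
    -- must first become a derivation, whence the mutual recursion with `reify`.
    reflect : ∀ F ρ → ⟦ F ⟧ ρ (substFormula ρ F ∷ [])
    reflect (atom p ts) ρ = initial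
    reflect (F ⊗ H) ρ k = ⊗L (k (_ , _ , ↭-refl , reflect F ρ , reflect H ρ))
    reflect (F ⊸ H) ρ {Γ} x =
      ⟦⟧-closed H ρ λ k →
        subst (_⊢ _) (sym (++-assoc Γ _ _))
          (exchange (shifts (_ ∷ []) Γ) (⊸L (reify F ρ x) (k (reflect H ρ))))
    reflect (F & H) ρ =
      closed-rule (⟦⟧-closed F ρ) &L₁ (reflect F ρ) ,
      closed-rule (⟦⟧-closed H ρ) &L₂ (reflect H ρ)
    reflect 𝟏 ρ k = 𝟏L (k refl)
    reflect ⊤ ρ = tt
    reflect (∃′ F) ρ k = ∃L-terms λ t →
      subst (λ H → H ∷ _ ⊢ _) (sym (lift-inst t ρ F)) (k (t , reflect F (t ∷ₛ ρ)))
    reflect (∀′ F) ρ t =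
      closed-rule (⟦⟧-closed F (t ∷ₛ ρ))
        (λ d → ∀L t (subst (λ H → H ∷ _ ⊢ _) (sym (lift-inst t ρ F)) d)) (reflect F (t ∷ₛ ρ))
    reflect (! a F) ρ k =
      -- The formula is its own promotable context: the product for a singleton is `a` times the
      -- unit.
      k ( (a , substFormula ρ F) ∷ [] , refl , subst (a ≤_) (sym (*-identityʳ a)) ≤-refl
        , closed-rule (⟦⟧-closed F ρ) dereliction (reflect F ρ))

    -- By `⊢-closed` only generators matter, and on those the right rule applies. For `⊸` the
    -- hypothesis itself, by `reflect`, is the argument.
    reify : ∀ F ρ → ⟦ F ⟧ ρ ⊆ (_⊢ substFormula ρ F)
    reify (atom p ts) ρ d = d
    reify (F ⊗ H) ρ h = ⊢-closed (cl-mono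
      (λ (_ , _ , p , x , y) → exchange (↭-sym p) (⊗R (reify F ρ x) (reify H ρ y))) h)
    reify (F ⊸ H) ρ h = ⊸R (reify H ρ (h (reflect F ρ)))
    reify (F & H) ρ (x , y) = &R (reify F ρ x) (reify H ρ y)
    reify 𝟏 ρ h = ⊢-closed (cl-mono (λ { refl → 𝟏R }) h)
    reify ⊤ ρ _ = ⊤R
    reify (∃′ F) ρ h = ⊢-closed (cl-mono
      (λ (t , x) → ∃R t (subst (_ ⊢_) (sym (lift-inst t ρ F)) (reify F (t ∷ₛ ρ) x))) h)
    reify (∀′ F) ρ h =
      ∀R-terms λ t → subst (_ ⊢_) (sym (lift-inst t ρ F)) (reify F (t ∷ₛ ρ) (h t))
    reify (! a F) ρ h = ⊢-closed (cl-mono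
      (λ { (Θ , refl , a≤ , x) → promotion Θ a≤ (reify F ρ x) }) h)

  reflect* : ∀ Γ → ⟦ Γ ⟧* var Γ
  reflect* []      = refl
  reflect* (F ∷ Γ) =
    F ∷ [] , Γ , ↭-refl ,
    subst (λ H → ⟦ F ⟧ var (H ∷ [])) (substFormula-var F) (reflect F var) , reflect* Γ

  cut-elimination : ∀ {κ Γ F} → κ ∣ Γ ⟶ F → Γ ⊢ F
  cut-elimination {Γ = Γ} {F} d =
    -- At the identity environment `Γ` lies in its own interpretation; soundness carries it into
    -- that of `F`.
    subst (Γ ⊢_) (substFormula-var F) (reify F var (sound d var (reflect* Γ)))

theorem3 : ∀ {c f r} (𝒜 : CSemiring c) (L : Language f r) →
    let open SELLS 𝒜 L in
    ∀ (Γ : List Formula) (F : Formula) →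
    with-cut ∣ Γ ⟶ F → cut-free ∣ Γ ⟶ F
theorem3 𝒜 L Γ F = CutElimination.cut-elimination 𝒜 L
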